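{- Let $G_1$ and $G_2$ be finite simple connected graphs. If $G_1$ is not isomorphic to $K_{1,1}$, then the eccentricity matrix $\epsilon(G_1 \,\dot\vee\, G_2)$ of the subdivision-vertex join $G_1 \,\dot\vee\, G_2$ is irreducible.
   Context: All graphs are finite, simple and undirected. The subdivision graph $S(G)$ of a graph $G$ is obtained from $G$ by subdividing each edge with one new vertex; $I(G)$ is the set of these new vertices, so $V(S(G))=V(G)\cup I(G)$. For vertex-disjoint graphs $G_1,G_2$, the subdivision-vertex join $G_1\,\dot\vee\,G_2$ is obtained from $S(G_1)$ and $G_2$ by joining each vertex of $V(G_1)$ to every vertex of $V(G_2)$ (the vertices of $I(G_1)$ receive no new edges). For a connected graph $G$ with distance function $d$, the eccentricity of a vertex $v$ is $e(v)=\max\{d(v,u):u\in V(G)\}$. The eccentricity matrix $\epsilon(G)$ is the symmetric matrix indexed by $V(G)$ with $(u,v)$ entry $d(u,v)$ if $d(u,v)=\min\{e(u),e(v)\}$, and $0$ otherwise. A square matrix $N$ is reducible if there is a permutation matrix $P$ with $N=P^T\begin{pmatrix}A&B\\0&C\end{pmatrix}P$, where $A$ and $C$ are (nonempty) square blocks; it is irreducible otherwise. $K_{1,1}$ is the complete bipartite graph on $1+1$ vertices. -}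

module Defs where

open import Data.Bool using (if_then_else_)
open import Data.Empty using (⊥)
open import Data.Fin using (Fin; splitAt; _<?_) renaming (_≟_ to _≟F_)
open import Data.Fin.Permutation using (Permutation; _⟨$⟩ʳ_)
open import Data.Fin.Properties using (+↔⊎; any?)
open import Data.Integer using (ℤ; +_; 0ℤ; 1ℤ) renaming (_*_ to _*ℤ_)
open import Data.Integer.Properties using (+-*-semiring)
open import Data.List using (List; length; lookup; filter; cartesianProduct; allFin; tabulate)
open import Data.List.Extrema.Nat using (max)
open import Data.Nat using (ℕ; zero; suc; _+_; _≤_; _⊓_; z≤n; s≤s; NonZero; _≟_)
open import Data.Product using (Σ-syntax; ∃-syntax; _×_; _,_; proj₁; proj₂)
open import Data.Sum using (_⊎_; inj₁; inj₂; [_,_]′)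
open import Data.Sum.Function.Propositional using (_⊎-↔_)
open import Data.Unit using (⊤; tt)
open import Function using (_∘_; id; _↔_; _⇔_; Inverse)
open import Function.Construct.Identity using (↔-id)
open import Function.Properties.Inverse using (↔-sym; ↔-trans; ↔⇒↣)
open import Level using (0ℓ)
open import Algebra.Properties.Semiring.Sum +-*-semiring using (sum)
open import Relation.Binary using (Rel; Symmetric; DecidableEquality)
  renaming (Decidable to Decidable₂)
open import Relation.Binary.PropositionalEquality using (_≡_; refl; sym; subst)
open import Relation.Nullary using (¬_; Dec; yes; no; contradiction)
open import Relation.Nullary.Decidable using (does; via-injection; map′; _×-dec_; _⊎-dec_)
open import Relation.Unary using (Pred; Decidable)

record Graph : Set₁ where
  no-eta-equality
  field
    Vertex     : Set
    order      : ℕ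
    enum       : Vertex ↔ Fin order
    Adj        : Rel Vertex 0ℓ
    adj?       : Decidable₂ Adj
    adj-sym    : Symmetric Adj
    adj-irrefl : ∀ {v} → ¬ Adj v v

  index : Vertex → Fin order
  index = Inverse.to enum

  vertex : Fin order → Vertex
  vertex = Inverse.from enum

  _≟ᵛ_ : DecidableEquality Vertex
  _≟ᵛ_ = via-injection (↔⇒↣ enum) _≟F_

  -- An edge {u , v} is listed exactly once: as the pair of indices of
  -- its ends, the smaller index first.
  edges : List (Fin order × Fin order)
  edges = filter (λ (i , j) → (i <? j) ×-dec adj? (vertex i) (vertex j))
                 (cartesianProduct (allFin order) (allFin order))

  Edge : Set
  Edge = Fin (length edges)

  end₁ end₂ : Edge → Vertex
  end₁ e = vertex (proj₁ (lookup edges e))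
  end₂ e = vertex (proj₂ (lookup edges e))

  Incident : Vertex → Edge → Set
  Incident v e = v ≡ end₁ e ⊎ v ≡ end₂ e

  incident? : Decidable₂ Incident
  incident? v e = (v ≟ᵛ end₁ e) ⊎-dec (v ≟ᵛ end₂ e)

  data Walk : ℕ → Rel Vertex 0ℓ where
    []  : ∀ {u} → Walk 0 u u
    _∷_ : ∀ {k u v w} → Adj u v → Walk k v w → Walk (suc k) u w

  walk? : ∀ k → Decidable₂ (Walk k)
  walk? zero u v = map′ (λ { refl → [] }) (λ { [] → refl }) (u ≟ᵛ v)
  walk? (suc k) u w =
    map′ (λ (_ , a , p) → a ∷ p)
         (λ { (_∷_ {v = v} a p) →
              index v ,
              subst (λ x → Adj u x × Walk k x w) (sym (vertex-index v)) (a , p) })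
         (any? λ i → adj? u (vertex i) ×-dec walk? k (vertex i) w)
    where
    vertex-index : ∀ v → vertex (index v) ≡ v
    vertex-index v = Inverse.inverseʳ enum refl

  -- A connected graph is understood to have at least one vertex.
  record Connected : Set where
    field
      point : Vertex
      walk  : ∀ u v → ∃[ k ] Walk k u v

open Graph using (Vertex; Edge; Connected)

record _≅_ (G H : Graph) : Set where
  private
    module G = Graph G
    module H = Graph H
  field
    bijection : G.Vertex ↔ H.Vertex
    adj⇔adj   : ∀ u v → G.Adj u v ⇔
                        H.Adj (Inverse.to bijection u) (Inverse.to bijection v)

module CompleteBipartite (m n : ℕ) where

  Across : Rel (Fin m ⊎ Fin n) 0ℓ
  Across (inj₁ _) (inj₁ _) = ⊥
  Across (inj₁ _) (inj₂ _) = ⊤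
  Across (inj₂ _) (inj₁ _) = ⊤
  Across (inj₂ _) (inj₂ _) = ⊥

  across? : Decidable₂ Across
  across? (inj₁ _) (inj₁ _) = no id
  across? (inj₁ _) (inj₂ _) = yes tt
  across? (inj₂ _) (inj₁ _) = yes tt
  across? (inj₂ _) (inj₂ _) = no id

  across-sym : ∀ u v → Across u v → Across v u
  across-sym (inj₁ _) (inj₂ _) _ = tt
  across-sym (inj₂ _) (inj₁ _) _ = tt

  across-irrefl : ∀ v → ¬ Across v v
  across-irrefl (inj₁ _) ()
  across-irrefl (inj₂ _) ()

K : ℕ → ℕ → Graph
K m n = record
  { Vertex     = Fin m ⊎ Fin n
  ; order      = m + n
  ; enum       = ↔-sym +↔⊎
  ; Adj        = Across
  ; adj?       = across?
  ; adj-sym    = λ {u} {v} → across-sym u v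
  ; adj-irrefl = λ {v} → across-irrefl v
  }
  where open CompleteBipartite m n

module Subdivision (G : Graph) where
  open Graph G using (Incident; incident?)

  AdjS : Rel (Vertex G ⊎ Edge G) 0ℓ
  AdjS (inj₁ _) (inj₁ _) = ⊥
  AdjS (inj₁ v) (inj₂ e) = Incident v e
  AdjS (inj₂ e) (inj₁ v) = Incident v e
  AdjS (inj₂ _) (inj₂ _) = ⊥

  adjS? : Decidable₂ AdjS
  adjS? (inj₁ _) (inj₁ _) = no id
  adjS? (inj₁ v) (inj₂ e) = incident? v e
  adjS? (inj₂ e) (inj₁ v) = incident? v e
  adjS? (inj₂ _) (inj₂ _) = no id

  adjS-sym : ∀ u v → AdjS u v → AdjS v u
  adjS-sym (inj₁ _) (inj₂ _) a = a
  adjS-sym (inj₂ _) (inj₁ _) a = a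

  adjS-irrefl : ∀ v → ¬ AdjS v v
  adjS-irrefl (inj₁ _) ()
  adjS-irrefl (inj₂ _) ()

-- inj₂ e is the new vertex that subdivides the edge e.
S : Graph → Graph
S G .Graph.Vertex          = Vertex G ⊎ Edge G
S G .Graph.order           = Graph.order G + length (Graph.edges G)
S G .Graph.enum            = ↔-trans (Graph.enum G ⊎-↔ ↔-id _) (↔-sym +↔⊎)
S G .Graph.Adj             = Subdivision.AdjS G
S G .Graph.adj?            = Subdivision.adjS? G
S G .Graph.adj-sym {u} {v} = Subdivision.adjS-sym G u v
S G .Graph.adj-irrefl {v}  = Subdivision.adjS-irrefl G v

module SubdivisionVertexJoin (G₁ G₂ : Graph) where
  private
    module SG₁ = Graph (S G₁)
    module G₂  = Graph G₂

  Joined : Vertex (S G₁) → Vertex G₂ → Set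
  Joined (inj₁ _) _ = ⊤
  Joined (inj₂ _) _ = ⊥

  joined? : ∀ x y → Dec (Joined x y)
  joined? (inj₁ _) _ = yes tt
  joined? (inj₂ _) _ = no id

  Adj∨ : Rel (Vertex (S G₁) ⊎ Vertex G₂) 0ℓ
  Adj∨ (inj₁ x) (inj₁ y) = SG₁.Adj x y
  Adj∨ (inj₁ x) (inj₂ y) = Joined x y
  Adj∨ (inj₂ y) (inj₁ x) = Joined x y
  Adj∨ (inj₂ x) (inj₂ y) = G₂.Adj x y

  adj∨? : Decidable₂ Adj∨
  adj∨? (inj₁ x) (inj₁ y) = SG₁.adj? x y
  adj∨? (inj₁ x) (inj₂ y) = joined? x y
  adj∨? (inj₂ y) (inj₁ x) = joined? x y
  adj∨? (inj₂ x) (inj₂ y) = G₂.adj? x y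

  adj∨-sym : ∀ u v → Adj∨ u v → Adj∨ v u
  adj∨-sym (inj₁ x) (inj₁ y) a = SG₁.adj-sym {x} {y} a
  adj∨-sym (inj₁ x) (inj₂ y) a = a
  adj∨-sym (inj₂ y) (inj₁ x) a = a
  adj∨-sym (inj₂ x) (inj₂ y) a = G₂.adj-sym a

  adj∨-irrefl : ∀ v → ¬ Adj∨ v v
  adj∨-irrefl (inj₁ x) = SG₁.adj-irrefl {x}
  adj∨-irrefl (inj₂ x) = G₂.adj-irrefl

infixl 6 _∨̇_
_∨̇_ : Graph → Graph → Graph
(G₁ ∨̇ G₂) .Graph.Vertex          = Vertex (S G₁) ⊎ Vertex G₂
(G₁ ∨̇ G₂) .Graph.order           = Graph.order (S G₁) + Graph.order G₂
(G₁ ∨̇ G₂) .Graph.enum            =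
  ↔-trans (Graph.enum (S G₁) ⊎-↔ Graph.enum G₂) (↔-sym +↔⊎)
(G₁ ∨̇ G₂) .Graph.Adj             = SubdivisionVertexJoin.Adj∨ G₁ G₂
(G₁ ∨̇ G₂) .Graph.adj?            = SubdivisionVertexJoin.adj∨? G₁ G₂
(G₁ ∨̇ G₂) .Graph.adj-sym {u} {v} = SubdivisionVertexJoin.adj∨-sym G₁ G₂ u v
(G₁ ∨̇ G₂) .Graph.adj-irrefl {v}  = SubdivisionVertexJoin.adj∨-irrefl G₁ G₂ v

∨̇-connected : ∀ {G₁ G₂} → Connected G₁ → Connected G₂ → Connected (G₁ ∨̇ G₂)
∨̇-connected {G₁} {G₂} c₁ c₂ = record
  { point = hub
  ; walk  = λ u v → let (j , p) = toHub u ; (k , q) = toHub v in j + k , p ++ reverse q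
  }
  where
  module G₁ = Graph G₁
  open Graph (G₁ ∨̇ G₂) using (Walk; []; _∷_; adj-sym)

  hub : Vertex (G₁ ∨̇ G₂)
  hub = inj₂ (Connected.point c₂)

  toHub : ∀ u → ∃[ k ] Walk k u hub
  toHub (inj₁ (inj₁ v)) = 1 , tt ∷ []
  toHub (inj₁ (inj₂ e)) = 2 , _∷_ {v = inj₁ (inj₁ (G₁.end₁ e))} (inj₁ refl) (tt ∷ [])
  toHub (inj₂ w) = 2 , _∷_ {v = inj₁ (inj₁ (Connected.point c₁))} tt (tt ∷ [])

  _++_ : ∀ {j k u v w} → Walk j u v → Walk k v w → Walk (j + k) u w
  []      ++ q = q
  (a ∷ p) ++ q = a ∷ (p ++ q)

  snoc : ∀ {k u v w} → Walk k u v → Graph.Adj (G₁ ∨̇ G₂) v w → Walk (suc k) u w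
  snoc []      b = b ∷ []
  snoc (a ∷ p) b = a ∷ snoc p b

  reverse : ∀ {k u v} → Walk k u v → Walk k v u
  reverse []                        = []
  reverse (_∷_ {u = u} {v = v} a p) = snoc (reverse p) (adj-sym {u} {v} a)

least : ∀ {P : Pred ℕ 0ℓ} → Decidable P → ∀ n → P n →
        ∃[ k ] (P k × (∀ j → P j → k ≤ j))
least P? zero p = 0 , p , λ _ _ → z≤n
least P? (suc n) p with P? 0
... | yes p₀ = 0 , p₀ , λ _ _ → z≤n
... | no ¬p₀ =
  let (k , pk , k≤) = least (P? ∘ suc) n p
  in suc k , pk , λ { zero p₀ → contradiction p₀ ¬p₀ ; (suc j) pj → s≤s (k≤ j pj) }

Matrix : ℕ → ℕ → Set
Matrix m n = Fin m → Fin n → ℤ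

infixl 7 _⊗_
_⊗_ : ∀ {l m n} → Matrix l m → Matrix m n → Matrix l n
(M ⊗ N) i j = sum (λ k → M i k *ℤ N k j)

_ᵀ : ∀ {m n} → Matrix m n → Matrix n m
(M ᵀ) i j = M j i

-- A permutation m ↔ n forces m ≡ n, so this matrix is square.
permutationMatrix : ∀ {m n} → Permutation m n → Matrix m n
permutationMatrix π i j = if does (π ⟨$⟩ʳ i ≟F j) then 1ℤ else 0ℤ

0ᴹ : ∀ {m n} → Matrix m n
0ᴹ _ _ = 0ℤ

block : ∀ {p q} → Matrix p p → Matrix p q → Matrix q p → Matrix q q →
        Matrix (p + q) (p + q)
block {p} A B C D i j =
  [ (λ i′ → [ A i′ , B i′ ]′ (splitAt p j))
  , (λ i′ → [ C i′ , D i′ ]′ (splitAt p j)) ]′ (splitAt p i)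

Reducible : ∀ {n} → Matrix n n → Set
Reducible {n} N =
  Σ[ p ∈ ℕ ] Σ[ q ∈ ℕ ] NonZero p × NonZero q ×
  Σ[ π ∈ Permutation (p + q) n ]
  Σ[ A ∈ Matrix p p ] Σ[ B ∈ Matrix p q ] Σ[ C ∈ Matrix q q ]
  (let P = permutationMatrix π in
   ∀ i j → N i j ≡ ((P ᵀ) ⊗ block A B 0ᴹ C ⊗ P) i j)

Irreducible : ∀ {n} → Matrix n n → Set
Irreducible N = ¬ Reducible N

module _ (G : Graph) (c : Connected G) where
  open Graph G using (order; vertex; walk?)

  -- The length of a shortest walk, which is that of a shortest path.
  dist : Vertex G → Vertex G → ℕ
  dist u v = let (n , p) = Connected.walk c u v in
    proj₁ (least (λ k → walk? k u v) n p)

  ecc : Vertex G → ℕ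
  ecc v = max 0 (tabulate (λ i → dist v (vertex i)))

  -- Rows and columns are indexed by the vertices in the order given by enum.
  ε : Matrix order order
  ε i j = let u = vertex i ; v = vertex j in
    if does (dist u v ≟ ecc u ⊓ ecc v) then + dist u v else 0ℤ

{-# OPTIONS --safe #-}

-- Join two vertices when both matrix entries they index are nonzero: a matrix
-- is irreducible as soon as the resulting graph is connected.  In ε G the
-- vertices u ≢ v are joined whenever v is at maximal distance from u, because
-- then d(u,v) = e(u) ≤ e(v).
--
-- If G₁ has an edge and every edge misses some vertex, then in G₁ ∨̇ G₂:
--   * e ∈ I(G₁) is at maximal distance 2 from every y ∈ V(G₂);
--   * e is at maximal distance 3 from every v ∈ V(G₁) it is not incident with;
--   * a v ∈ V(G₁) incident with all edges has eccentricity 2, attained at every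
--     other vertex of G₁, in particular at one missed by some edge.
-- If G₁ has no edge, it is a single vertex at distance 1 from all of V(G₂).  If
-- some edge misses no vertex, then G₁ ≅ K 1 1.

module Submission where

open import Defs
open import Relation.Nullary using (¬_)

open import Data.Bool using (Bool; true; false)
open import Data.Fin using (Fin; zero; suc; splitAt; _↑ˡ_; _↑ʳ_; _<_; _<?_) renaming (_≟_ to _≟F_)
open import Data.Fin.Permutation using (Permutation; _⟨$⟩ʳ_; _⟨$⟩ˡ_; inverseˡ)
open import Data.Fin.Properties
  using (<-cmp; any?; all?; ¬∀⟶∃¬; splitAt-↑ˡ; splitAt-↑ʳ)
open import Data.Integer using (ℤ; +_; 0ℤ) renaming (_*_ to _*ℤ_)
open import Data.Integer.Properties using (+-*-semiring; *-zeroʳ; +-injective)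
open import Algebra.Properties.Semiring.Sum +-*-semiring using (sum; sum-cong-≗; sum-replicate-zero)
open import Data.List using (lookup; cartesianProduct; allFin)
open import Data.List.Extrema.Nat using (max≤v⁺; v≤max⁺)
open import Data.List.Membership.Propositional.Properties
  using (∈-filter⁺; ∈-filter⁻; ∈-lookup; ∈-cartesianProduct⁺; ∈-allFin)
import Data.List.Relation.Unary.All.Properties as All
import Data.List.Relation.Unary.Any as Any
import Data.List.Relation.Unary.Any.Properties as Any
open import Data.Nat using (ℕ; suc; _⊓_; _≤_; z≤n; s≤s; _≟_)
open import Data.Nat.Properties using (≤-antisym; ≤-reflexive; ≤-trans; m⊓n≤m; ⊓-glb; ⊓-comm)
open import Data.Product using (∃-syntax; _×_; _,_; proj₁; proj₂)
open import Data.Sum using (_⊎_; inj₁; inj₂)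
open import Data.Unit using (⊤; tt)
open import Function using (_∘_; Inverse; mk↔ₛ′; mk⇔)
open import Relation.Binary using (tri<; tri≈; tri>)
open import Relation.Binary.PropositionalEquality
  using (_≡_; _≢_; refl; sym; trans; cong; subst; subst₂)
open import Relation.Nullary using (yes; no; contradiction)
open import Relation.Nullary.Decidable using (dec-true; dec-false; _×-dec_)

-- Reducibility and two-colourings of the indices.

sum-zero : ∀ {n} (f : Fin n → ℤ) → (∀ i → f i ≡ 0ℤ) → sum f ≡ 0ℤ
sum-zero {n} f f≡0 = trans (sum-cong-≗ f≡0) (sum-replicate-zero n)

permutationMatrix-zero : ∀ {m n} (π : Permutation m n) {i j} →
                         π ⟨$⟩ʳ i ≢ j → permutationMatrix π i j ≡ 0ℤ
permutationMatrix-zero π {i} {j} πi≢j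
  rewrite dec-false (π ⟨$⟩ʳ i ≟F j) πi≢j = refl

block-lower-left : ∀ {p q} (A : Matrix p p) B (C : Matrix q q) x y {k l} →
                   splitAt p x ≡ inj₂ k → splitAt p y ≡ inj₁ l →
                   block A B 0ᴹ C x y ≡ 0ℤ
block-lower-left _ _ _ _ _ x∈C y∈A rewrite x∈C | y∈A = refl

-- A class may be empty. Connectedness is tested by such colourings instead of paths: it means that
-- every colouring agreeing on joined indices is constant.
Bipartition : ℕ → Set
Bipartition n = Fin n → Bool

Respects : ∀ {n} → Bipartition n → Matrix n n → Set
Respects s N = ∀ i j → N i j ≢ 0ℤ → N j i ≢ 0ℤ → s i ≡ s j

-- A block form colours each index by its diagonal block. Of two indices in different blocks, one of
-- the entries `N i j`, `N j i` lies in the zero block, so this colouring respects `N`.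
irreducible : ∀ {n} (N : Matrix n n) →
              (∀ s → Respects s N → ∀ i j → s i ≡ s j) → Irreducible N
irreducible {n} N constant
  (suc p , suc q , _ , _ , π , A , B , C , N≡) =
  -- Both blocks are nonempty, so each has an index `zero`, and these two have different colours.
  contradiction (trans (sym (left zero)) (trans (constant s respects _ _) (right zero))) λ ()
  where
  isLeft : ∀ {a b} → Fin a ⊎ Fin b → Bool
  isLeft (inj₁ _) = true
  isLeft (inj₂ _) = false

  s : Bipartition n
  s i = isLeft (splitAt (suc p) (π ⟨$⟩ˡ i))

  left : ∀ l → s (π ⟨$⟩ʳ (l ↑ˡ suc q)) ≡ true
  left l = cong isLeft (trans (cong (splitAt (suc p)) (inverseˡ π)) (splitAt-↑ˡ (suc p) l (suc q)))

  right : ∀ k → s (π ⟨$⟩ʳ (suc p ↑ʳ k)) ≡ false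
  right k = cong isLeft (trans (cong (splitAt (suc p)) (inverseˡ π)) (splitAt-↑ʳ (suc p) (suc q) k))

  P = permutationMatrix π
  M = block A B 0ᴹ C

  -- In the double sum for `N i j`, the permutation matrices kill every term except the one at the
  -- preimages of `i` and `j`, and there the entry of `M` is zero.
  zero-block : ∀ i j {k l} → splitAt (suc p) (π ⟨$⟩ˡ i) ≡ inj₂ k →
               splitAt (suc p) (π ⟨$⟩ˡ j) ≡ inj₁ l → N i j ≡ 0ℤ
  zero-block i j i∈C j∈A = trans (N≡ i j) (sum-zero _ column)
    where
    entry : M (π ⟨$⟩ˡ i) (π ⟨$⟩ˡ j) ≡ 0ℤ
    entry = block-lower-left A B C (π ⟨$⟩ˡ i) (π ⟨$⟩ˡ j) i∈C j∈A

    off : ∀ {x y} → x ≢ π ⟨$⟩ˡ y → P x y ≡ 0ℤ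
    off x≢ = permutationMatrix-zero π (λ { refl → x≢ (sym (inverseˡ π)) })

    row : ∀ x → P x i *ℤ M x (π ⟨$⟩ˡ j) ≡ 0ℤ
    row x with x ≟F π ⟨$⟩ˡ i
    ... | yes refl = trans (cong (P x i *ℤ_) entry) (*-zeroʳ (P x i))
    ... | no x≢    = cong (_*ℤ M x (π ⟨$⟩ˡ j)) (off x≢)

    column : ∀ y → ((P ᵀ) ⊗ M) i y *ℤ P y j ≡ 0ℤ
    column y with y ≟F π ⟨$⟩ˡ j
    ... | yes refl = cong (_*ℤ P y j) (sum-zero _ row)
    ... | no y≢    = trans (cong (((P ᵀ) ⊗ M) i y *ℤ_) (off y≢)) (*-zeroʳ (((P ᵀ) ⊗ M) i y))

  respects : Respects s N
  respects i j Nij≢0 Nji≢0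
    with splitAt (suc p) (π ⟨$⟩ˡ i) in i∈ | splitAt (suc p) (π ⟨$⟩ˡ j) in j∈
  ... | inj₁ _ | inj₁ _ = refl
  ... | inj₂ _ | inj₂ _ = refl
  ... | inj₁ _ | inj₂ _ = contradiction (zero-block j i j∈ i∈) Nji≢0
  ... | inj₂ _ | inj₁ _ = contradiction (zero-block i j i∈ j∈) Nij≢0

-- Edges, the graph `K 1 1`, and eccentricities.

module GraphProperties (G : Graph) where
  open Graph G

  vertex-index : ∀ v → vertex (index v) ≡ v
  vertex-index v = Inverse.inverseʳ enum refl

  index-vertex : ∀ i → index (vertex i) ≡ i
  index-vertex i = Inverse.inverseˡ enum refl

  index-injective : ∀ {u v} → index u ≡ index v → u ≡ v
  index-injective {u} {v} eq =
    trans (sym (vertex-index u)) (trans (cong vertex eq) (vertex-index v))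

  snoc : ∀ {k u v w} → Walk k u v → Adj v w → Walk (suc k) u w
  snoc []      b = b ∷ []
  snoc (a ∷ p) b = a ∷ snoc p b

  reverse : ∀ {k u v} → Walk k u v → Walk k v u
  reverse []      = []
  reverse (a ∷ p) = snoc (reverse p) (adj-sym a)

  private
    listed : ∀ e → proj₁ (lookup edges e) < proj₂ (lookup edges e)
                 × Adj (end₁ e) (end₂ e)
    listed e = proj₂ (∈-filter⁻
      (λ (i , j) → (i <? j) ×-dec adj? (vertex i) (vertex j))
      {xs = cartesianProduct (allFin order) (allFin order)} (∈-lookup e))

    list : ∀ {u v} → index u < index v → Adj u v → Edge
    list {u} {v} u<v a = Any.index (∈-filter⁺
      (λ (i , j) → (i <? j) ×-dec adj? (vertex i) (vertex j))
      (∈-cartesianProduct⁺ (∈-allFin (index u)) (∈-allFin (index v)))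
      (u<v , subst₂ Adj (sym (vertex-index u)) (sym (vertex-index v)) a))

  ends-adjacent : ∀ e → Adj (end₁ e) (end₂ e)
  ends-adjacent = proj₂ ∘ listed

  -- Edges are listed with the smaller index first, so comparing indices selects the orientation;
  -- equal indices would give a loop.
  adjacent⇒edge : ∀ {u v} → Adj u v → Edge
  adjacent⇒edge {u} {v} a with <-cmp (index u) (index v)
  ... | tri< u<v _ _ = list u<v a
  ... | tri> _ _ v<u = list v<u (adj-sym a)
  ... | tri≈ _ u≡v _ = contradiction (subst (Adj u) (sym (index-injective u≡v)) a) adj-irrefl

  edgeless⇒trivial : Connected → ¬ Edge → ∀ u v → u ≡ v
  edgeless⇒trivial c ¬e u v with Connected.walk c u v
  ... | _ , []    = refl
  ... | _ , a ∷ _ = contradiction (adjacent⇒edge a) ¬e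

  -- Every vertex is an end of `e`, so comparison with `end₁ e` alone decides its side; the ends
  -- differ, being adjacent. Pulling back along `from` leaves adjacency to be checked on the two
  -- ends only.
  spanningEdge⇒K₁₁ : ∀ e → (∀ v → Incident v e) → G ≅ K 1 1
  spanningEdge⇒K₁₁ e spanning = record
    { bijection = mk↔ₛ′ to from to∘from from∘to
    ; adj⇔adj   = λ u v → mk⇔ (preserves u v) (reflects u v)
    }
    where
    a = ends-adjacent e

    to : Vertex → Fin 1 ⊎ Fin 1
    to v with v ≟ᵛ end₁ e
    ... | yes _ = inj₁ zero
    ... | no  _ = inj₂ zero

    from : Fin 1 ⊎ Fin 1 → Vertex
    from (inj₁ _) = end₁ e
    from (inj₂ _) = end₂ e

    to∘from : ∀ x → to (from x) ≡ x
    to∘from (inj₁ zero) with end₁ e ≟ᵛ end₁ e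
    ... | yes _ = refl
    ... | no ≢  = contradiction refl ≢
    to∘from (inj₂ zero) with end₂ e ≟ᵛ end₁ e
    ... | yes eq = contradiction (subst (Adj (end₁ e)) eq a) adj-irrefl
    ... | no _   = refl

    from∘to : ∀ v → from (to v) ≡ v
    from∘to v with v ≟ᵛ end₁ e | spanning v
    ... | yes eq | _       = sym eq
    ... | no ≢   | inj₁ eq = contradiction eq ≢
    ... | no _   | inj₂ eq = sym eq

    Across : Fin 1 ⊎ Fin 1 → Fin 1 ⊎ Fin 1 → Set
    Across = Graph.Adj (K 1 1)

    adj⇒across : ∀ x y → Adj (from x) (from y) → Across x y
    adj⇒across (inj₁ _) (inj₁ _) = adj-irrefl
    adj⇒across (inj₁ _) (inj₂ _) _ = tt
    adj⇒across (inj₂ _) (inj₁ _) _ = tt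
    adj⇒across (inj₂ _) (inj₂ _) = adj-irrefl

    across⇒adj : ∀ x y → Across x y → Adj (from x) (from y)
    across⇒adj (inj₁ _) (inj₂ _) _ = a
    across⇒adj (inj₂ _) (inj₁ _) _ = adj-sym a

    preserves : ∀ u v → Adj u v → Across (to u) (to v)
    preserves u v = adj⇒across (to u) (to v) ∘ subst₂ Adj (sym (from∘to u)) (sym (from∘to v))

    reflects : ∀ u v → Across (to u) (to v) → Adj u v
    reflects u v = subst₂ Adj (from∘to u) (from∘to v) ∘ across⇒adj (to u) (to v)

  -- v is at distance e(u) = suc k from u.
  record Farthest (u v : Vertex) : Set where
    field
      {k}    : ℕ
      within : ∀ w → ∃[ j ] (j ≤ suc k × Walk j u w)
      beyond : ∀ {j} → Walk j u v → suc k ≤ j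

  module _ (c : Connected) where
    private
      d = dist G c
      e = ecc G c

    dist-walk : ∀ u v → Walk (d u v) u v
    dist-walk u v = let (n , p) = Connected.walk c u v in
      proj₁ (proj₂ (least (λ k → walk? k u v) n p))

    dist-minimal : ∀ {k} u v → Walk k u v → d u v ≤ k
    dist-minimal u v = let (n , p) = Connected.walk c u v in
      proj₂ (proj₂ (least (λ k → walk? k u v) n p)) _

    dist-sym : ∀ u v → d u v ≡ d v u
    dist-sym u v = ≤-antisym (dist-minimal u v (reverse (dist-walk v u)))
                             (dist-minimal v u (reverse (dist-walk u v)))

    dist≤ecc : ∀ u v → d u v ≤ e u
    dist≤ecc u v = v≤max⁺ 0 _ (inj₂ (Any.tabulate⁺ (index v)
      (≤-reflexive (cong (d u) (sym (vertex-index v))))))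

    -- A distance never exceeds the eccentricity of either end. Conversely, `within` bounds e(u) by
    -- `suc k`, which `beyond` bounds by d(u,v).
    farthest⇒dist≡ : ∀ {u v} → Farthest u v → d u v ≡ e u ⊓ e v
    farthest⇒dist≡ {u} {v} far = ≤-antisym
      (⊓-glb (dist≤ecc u v) (subst (_≤ e v) (dist-sym v u) (dist≤ecc v u)))
      (≤-trans (m⊓n≤m (e u) (e v)) (max≤v⁺ z≤n (All.tabulate⁺ (bound ∘ vertex))))
      where
      open Farthest far
      bound : ∀ w → d u w ≤ d u v
      bound w = let (_ , j≤ , p) = within w in
        ≤-trans (dist-minimal u w p) (≤-trans j≤ (beyond (dist-walk u v)))

    -- Needed because an entry that satisfies the minimum condition could still be a zero distance.
    farthest⇒dist≢0 : ∀ {u v} → Farthest u v → d u v ≢ 0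
    farthest⇒dist≢0 {u} {v} far ≡0 with d u v | dist-walk u v
    farthest⇒dist≢0 far refl | _ | p with Farthest.beyond far p
    ... | ()

    ε≢0 : ∀ i j → d (vertex i) (vertex j) ≡ e (vertex i) ⊓ e (vertex j) →
          d (vertex i) (vertex j) ≢ 0 → ε G c i j ≢ 0ℤ
    ε≢0 i j d≡ d≢0
      rewrite dec-true (d (vertex i) (vertex j) ≟ e (vertex i) ⊓ e (vertex j)) d≡ =
      d≢0 ∘ +-injective

    -- `Farthest` is directed, but distance and the minimum of eccentricities are symmetric, so one
    -- such pair makes both entries nonzero.
    ε-irreducible :
      (∀ (s : Vertex → Bool) → (∀ {u v} → Farthest u v → s u ≡ s v) → ∀ u v → s u ≡ s v) →
      Irreducible (ε G c)
    ε-irreducible constant = irreducible _ λ s respects i j →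
      subst₂ (λ i j → s i ≡ s j) (index-vertex i) (index-vertex j)
        (constant (s ∘ index) (joined respects) (vertex i) (vertex j))
      where
      joined : ∀ {s} → Respects s (ε G c) → ∀ {u v} → Farthest u v → s (index u) ≡ s (index v)
      joined respects {u} {v} far = respects (index u) (index v)
        (ε≢0 _ _ (farthest⇒dist≡ far′) (farthest⇒dist≢0 far′))
        (ε≢0 _ _ (trans (dist-sym y x) (trans (farthest⇒dist≡ far′) (⊓-comm (e x) (e y))))
                 (farthest⇒dist≢0 far′ ∘ trans (dist-sym x y)))
        where
        x = vertex (index u)
        y = vertex (index v)
        far′ : Farthest x y
        far′ = subst₂ Farthest (sym (vertex-index u)) (sym (vertex-index v)) far

-- Farthest pairs in the subdivision-vertex join.

module Join (G₁ G₂ : Graph) (c₁ : Graph.Connected G₁) (c₂ : Graph.Connected G₂) where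
  private
    module G₁ = Graph G₁
    module G₂ = Graph G₂
  open Graph (G₁ ∨̇ G₂) using (Vertex; Adj; Walk; []; _∷_)
  open GraphProperties (G₁ ∨̇ G₂) using (Farthest)

  pattern V₁ v = inj₁ (inj₁ v)
  pattern I e  = inj₁ (inj₂ e)
  pattern V₂ y = inj₂ y

  hub : G₂.Vertex
  hub = Graph.Connected.point c₂

  base : G₁.Vertex
  base = Graph.Connected.point c₁

  -- Takes the vertices explicitly, since they cannot be inferred from adjacency proofs such as
  -- `tt`.
  step : ∀ {k w} u v → Adj u v → Walk k v w → Walk (suc k) u w
  step _ _ a p = a ∷ p

  V₁→V₁ : ∀ v w → Walk 2 (V₁ v) (V₁ w)
  V₁→V₁ v w = step _ (V₂ hub) tt (step _ (V₁ w) tt [])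

  V₁→V₂ : ∀ v y → Walk 1 (V₁ v) (V₂ y)
  V₁→V₂ v y = step _ (V₂ y) tt []

  end→I : ∀ e → Walk 1 (V₁ (G₁.end₁ e)) (I e)
  end→I e = step _ (I e) (inj₁ refl) []

  V₁→I : ∀ v e → Walk 3 (V₁ v) (I e)
  V₁→I v e = step _ (V₂ hub) tt (step _ (V₁ (G₁.end₁ e)) tt (end→I e))

  V₂-I-farthest : ∀ y e → Farthest (V₂ y) (I e)
  V₂-I-farthest y e = record { k = 1 ; within = within ; beyond = beyond }
    where
    within : ∀ w → ∃[ j ] (j ≤ 2 × Walk j (V₂ y) w)
    within (V₁ v) = 1 , s≤s z≤n , step _ (V₁ v) tt []
    within (I f)  = 2 , s≤s (s≤s z≤n) , step _ (V₁ (G₁.end₁ f)) tt (end→I f)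
    -- This walk also serves for `z` equal to `y`: only an upper bound on the distance is required.
    within (V₂ z) = 2 , s≤s (s≤s z≤n) , step _ (V₁ base) tt (V₁→V₂ base z)

    beyond : ∀ {j} → Walk j (V₂ y) (I e) → 2 ≤ j
    beyond (() ∷ [])
    beyond (_ ∷ (_ ∷ _)) = s≤s (s≤s z≤n)

  -- The last step into `I e` leaves an end of `e`, which is not `v`; and no two vertices of V(G₁)
  -- are adjacent in the join, so two steps cannot suffice.
  V₁-I-farthest : ∀ v e → ¬ G₁.Incident v e → Farthest (V₁ v) (I e)
  V₁-I-farthest v e ¬inc = record { k = 2 ; within = within ; beyond = beyond }
    where
    within : ∀ w → ∃[ j ] (j ≤ 3 × Walk j (V₁ v) w)
    within (V₁ w) = 2 , s≤s (s≤s z≤n) , V₁→V₁ v w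
    within (I f)  = 3 , s≤s (s≤s (s≤s z≤n)) , V₁→I v f
    within (V₂ z) = 1 , s≤s z≤n , V₁→V₂ v z

    beyond : ∀ {j} → Walk j (V₁ v) (I e) → 3 ≤ j
    beyond (inc ∷ []) = contradiction inc ¬inc
    beyond (_∷_ {v = V₁ _} () (_ ∷ []))
    beyond (_∷_ {v = I _} _ (() ∷ []))
    beyond (_∷_ {v = V₂ _} _ (() ∷ []))
    beyond (_ ∷ (_ ∷ (_ ∷ _))) = s≤s (s≤s (s≤s z≤n))

  -- Incidence with every edge puts all of I(G₁) one step from `v`, so nothing is farther than 2.
  V₁-V₁-farthest : ∀ v w → v ≢ w → (∀ e → G₁.Incident v e) → Farthest (V₁ v) (V₁ w)
  V₁-V₁-farthest v w v≢w inc = record { k = 1 ; within = within ; beyond = beyond }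
    where
    within : ∀ x → ∃[ j ] (j ≤ 2 × Walk j (V₁ v) x)
    within (V₁ x) = 2 , s≤s (s≤s z≤n) , V₁→V₁ v x
    within (I e)  = 1 , s≤s z≤n , step _ (I e) (inc e) []
    within (V₂ z) = 1 , s≤s z≤n , V₁→V₂ v z

    beyond : ∀ {j} → Walk j (V₁ v) (V₁ w) → 2 ≤ j
    beyond []          = contradiction refl v≢w
    beyond (() ∷ [])
    beyond (_ ∷ (_ ∷ _)) = s≤s (s≤s z≤n)

  V₁-V₂-farthest : ¬ G₁.Edge → (∀ u v → u ≡ v) → ∀ v y → Farthest (V₁ v) (V₂ y)
  V₁-V₂-farthest ¬edge trivial v y = record { k = 0 ; within = within ; beyond = beyond }
    where
    within : ∀ w → ∃[ j ] (j ≤ 1 × Walk j (V₁ v) w)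
    within (V₁ w) = 0 , z≤n , subst (λ x → Walk 0 (V₁ v) (V₁ x)) (trivial v w) []
    within (I e)  = contradiction e ¬edge
    within (V₂ z) = 1 , s≤s z≤n , V₁→V₂ v z

    beyond : ∀ {j} → Walk j (V₁ v) (V₂ y) → 1 ≤ j
    beyond (_ ∷ _) = s≤s z≤n

  -- Colourings that agree on farthest pairs of the join.

  module _ (s : Vertex → Bool) (joined : ∀ {u v} → Farthest u v → s u ≡ s v) where

    constant-edgeless : ¬ G₁.Edge → ∀ u → s u ≡ s (V₁ base)
    constant-edgeless ¬edge = go
      where
      trivial = GraphProperties.edgeless⇒trivial G₁ c₁ ¬edge

      go : ∀ u → s u ≡ s (V₁ base)
      go (V₁ v) = cong (λ x → s (V₁ x)) (trivial v base)
      go (I e)  = contradiction e ¬edge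
      go (V₂ y) = sym (joined (V₁-V₂-farthest ¬edge trivial base y))

    constant-missing : G₁.Edge → (∀ e → ∃[ v ] ¬ G₁.Incident v e) → ∀ u → s u ≡ s (V₂ hub)
    constant-missing e₀ missing = go
      where
      edge : ∀ e → s (I e) ≡ s (V₂ hub)
      edge e = sym (joined (V₂-I-farthest hub e))

      missed : ∀ v e → ¬ G₁.Incident v e → s (V₁ v) ≡ s (V₂ hub)
      missed v e ¬inc = trans (joined (V₁-I-farthest v e ¬inc)) (edge e)

      go : ∀ u → s u ≡ s (V₂ hub)
      go (V₁ v) with all? (λ e → G₁.incident? v e)
      ... | no ¬inc = let (e , ¬inc-e) = ¬∀⟶∃¬ _ _ (λ e → G₁.incident? v e) ¬inc in
                      missed v e ¬inc-e
      -- The vertex `w` missed by `e₀` differs from `v`, which is incident with `e₀`, and its colour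
      -- is already known.
      ... | yes inc = let (w , ¬inc) = missing e₀ in
                      trans (joined (V₁-V₁-farthest v w (λ { refl → ¬inc (inc e₀) }) inc))
                            (missed w e₀ ¬inc)
      go (I e)  = edge e
      go (V₂ y) = trans (joined (V₂-I-farthest y e₀)) (edge e₀)

    constant : ¬ (G₁ ≅ K 1 1) → ∀ u v → s u ≡ s v
    -- Searching with the trivial predicate decides whether G₁ has an edge at all.
    constant ¬K₁₁ with any? {P = λ (_ : G₁.Edge) → ⊤} (λ _ → yes tt)
    ... | no ¬edge     = λ u v → trans (const u) (sym (const v))
      where const = constant-edgeless (λ e → ¬edge (e , tt))
    ... | yes (e₀ , _) = λ u v → trans (const u) (sym (const v))
      where
      missing : ∀ e → ∃[ v ] ¬ G₁.Incident v e
      missing e with all? (λ i → G₁.incident? (G₁.vertex i) e)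
      ... | yes inc = contradiction (GraphProperties.spanningEdge⇒K₁₁ G₁ e spanning) ¬K₁₁
        where
        spanning : ∀ v → G₁.Incident v e
        spanning v = subst (λ x → G₁.Incident x e)
          (GraphProperties.vertex-index G₁ v) (inc (G₁.index v))
      ... | no ¬inc = let (i , ¬inc-i) = ¬∀⟶∃¬ _ _ (λ i → G₁.incident? (G₁.vertex i) e) ¬inc in
                      G₁.vertex i , ¬inc-i

      const = constant-missing e₀ missing

theorem3p1 : (G₁ G₂ : Graph) (c₁ : Graph.Connected G₁) (c₂ : Graph.Connected G₂) →
    ¬ (G₁ ≅ K 1 1) → Irreducible (ε (G₁ ∨̇ G₂) (∨̇-connected c₁ c₂))
theorem3p1 G₁ G₂ c₁ c₂ ¬K₁₁ =
  GraphProperties.ε-irreducible (G₁ ∨̇ G₂) (∨̇-connected c₁ c₂)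
    (λ s joined → Join.constant G₁ G₂ c₁ c₂ s joined ¬K₁₁)
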